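{- Let $G$ be a graph. Then $\hat{\varphi}(G) = 0$ if and only if $G$ is paw-free and perfect. Also, $\varphi(G) = 0$ if and only if $G$ is complete multipartite.
   Context: All graphs are finite, simple and undirected, with at least one vertex. $\chi$ denotes the chromatic number. For a proper vertex coloring $c$ of $G$ and an induced subgraph $H$ of $G$, let $c(H)$ be the set of colors used by $c$ on the vertices of $H$. Define $\varphi_c(G)=\max_{H}\,(|c(H)|-\chi(H))$ over all induced subgraphs $H$ of $G$, and $\hat{\varphi}_c(G)$ as the same maximum taken only over all connected induced subgraphs $H$ of $G$. Define $\varphi(G)=\min_c \varphi_c(G)$ and $\hat{\varphi}(G)=\min_c \hat{\varphi}_c(G)$, the minima over all proper colorings $c$ of $G$ (with any number of colors). The paw is the graph on 4 vertices consisting of a triangle together with one further vertex adjacent to exactly one vertex of the triangle; paw-free means having no induced subgraph isomorphic to the paw. A graph is perfect if every induced subgraph has chromatic number equal to its clique number. A graph is complete multipartite if its vertices can be partitioned into independent sets with any two vertices in different sets adjacent (a single part, i.e. an edgeless graph, is allowed). -}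

module Defs where

open import Data.Bool.Base using (Bool; true; false; T)
open import Data.Bool.Properties using (T?)
open import Data.Fin.Base using (Fin; zero; suc; toℕ; fromℕ<; finToFun; funToFin)
open import Data.Fin.Patterns using (0F; 1F; 2F; 3F)
open import Data.Fin.Properties
  using (_≟_; any?; all?; toℕ-injective; finToFun-funToFin)
open import Data.Fin.Subset using (Subset; inside; outside; ⁅_⁆; _∈_; ∣_∣; Nonempty; ⊥)
open import Data.Fin.Subset.Properties
  using (_∈?_; nonempty?; anySubset?; ∉⊥; x∈⁅x⁆; ∣⁅x⁆∣≡1)
open import Data.List.Base using (List; []; _∷_; map; tabulate; filter; deduplicate; length; allFin)
open import Data.List.Properties using (map-tabulate; length-map; filter-≐)
open import Data.List.Membership.Propositional renaming (_∈_ to _∈ˡ_)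
open import Data.List.Membership.Propositional.Properties using (∈-allFin)
open import Data.List.Relation.Unary.Any using (here; there)
open import Data.Nat.Base using (ℕ; zero; suc; _∸_; _⊔_; _≤_; z≤n; s≤s; NonZero; >-nonZero⁻¹)
open import Data.Nat.Properties as ℕ
  using (≤-refl; ≤-trans; ≤-antisym; ≤-pred; ≤∧≢⇒<; n≤0⇒n≡0; m≤m⊔n; m≤n⊔m)
open import Data.Product using (∃; ∃-syntax; _×_; _,_; proj₁; proj₂)
open import Data.Sum using (_⊎_; inj₁; inj₂)
open import Data.Vec.Base using ([]; _∷_)
open import Function.Base using (_∘_; id; _on_)
open import Function.Bundles using (_⇔_; mk⇔; Equivalence; _↔_; Inverse)
open import Level using (0ℓ)
open import Relation.Binary using (Rel; Symmetric; Irreflexive; Decidable)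
open import Relation.Binary.Construct.Closure.ReflexiveTransitive using (Star; ε; _◅_; _◅◅_)
open import Relation.Binary.PropositionalEquality
  using (_≡_; _≢_; _≗_; refl; sym; trans; cong; subst; module ≡-Reasoning)
open import Relation.Nullary using (¬_; Dec; yes; no; contradiction; ¬?)
open import Relation.Nullary.Decidable
  using (map′; from-yes; _×-dec_; _⊎-dec_; _→-dec_; does)
import Relation.Unary as U

infix 4 _≅_
infix 20 _[_]

private
  variable
    m n : ℕ

------------------------------------------------------------------------
-- Minima and maxima of sets of natural numbers

IsMinimum IsMaximum : (ℕ → Set) → ℕ → Set
IsMinimum P m = P m × (∀ k → P k → m ≤ k)
IsMaximum P m = P m × (∀ k → P k → k ≤ m)

minimum : {P : ℕ → Set} → U.Decidable P → ∀ k → P k → ∃ (IsMinimum P)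
minimum P? zero p = zero , p , λ _ _ → z≤n
minimum {P} P? (suc k) p with P? 0
... | yes p₀ = 0 , p₀ , λ _ _ → z≤n
... | no ¬p₀ with minimum (P? ∘ suc) k p
...   | m , pm , least = suc m , pm , lower
  where
  lower : ∀ j → P j → suc m ≤ j
  lower zero    q = contradiction q ¬p₀
  lower (suc j) q = s≤s (least j q)

-- The values of f on the subsets satisfying Q.
ValueOver : (Subset n → Set) → (Subset n → ℕ) → ℕ → Set
ValueOver Q f m = ∃[ p ] Q p × f p ≡ m

private
  bounded-maximum : {P : ℕ → Set} → U.Decidable P → ∀ b → (∀ k → P k → k ≤ b) →
                    ∃ P → ∃ (IsMaximum P)
  bounded-maximum {P} P? b bnd (k , p) with P? b
  ... | yes q = b , q , bnd
  bounded-maximum {P} P? zero bnd (k , p) | no ¬q =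
    contradiction (subst P (n≤0⇒n≡0 (bnd k p)) p) ¬q
  bounded-maximum {P} P? (suc b) bnd kp | no ¬q =
    bounded-maximum P? b (λ k p → ≤-pred (≤∧≢⇒< (bnd k p) (λ e → ¬q (subst P e p)))) kp

  bound : (f : Subset n → ℕ) → ∃[ b ] (∀ p → f p ≤ b)
  bound {zero}  f = f [] , λ { [] → ≤-refl }
  bound {suc n} f with bound (f ∘ (inside ∷_)) | bound (f ∘ (outside ∷_))
  ... | a , f≤a | b , f≤b = a ⊔ b , λ
    { (inside  ∷ p) → ≤-trans (f≤a p) (m≤m⊔n a b)
    ; (outside ∷ p) → ≤-trans (f≤b p) (m≤n⊔m a b) }

maximumOver : {Q : Subset n → Set} → U.Decidable Q → ∃ Q → (f : Subset n → ℕ) →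
              ∃ (IsMaximum (ValueOver Q f))
maximumOver Q? (p , q) f with bound f
... | b , f≤b = bounded-maximum
  (λ m → anySubset? (λ p → Q? p ×-dec (f p ℕ.≟ m))) b
  (λ { _ (p , _ , refl) → f≤b p })
  (f p , p , q , refl)

------------------------------------------------------------------------
-- Graphs

-- The decidability field is no restriction classically: it makes the
-- numerical invariants below total functions.
record Graph (n : ℕ) : Set₁ where
  field
    Adj    : Rel (Fin n) 0ℓ
    symm   : Symmetric Adj
    irrefl : Irreflexive _≡_ Adj
    adj?   : Decidable Adj

open Graph public

_≅_ : Graph m → Graph n → Set
_≅_ {m} {n} G H = ∃ λ (f : Fin m ↔ Fin n) →
  ∀ u v → Adj G u v ⇔ Adj H (Inverse.to f u) (Inverse.to f v)

-- The increasing enumeration of the elements of p.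
embed : (p : Subset n) → Fin ∣ p ∣ → Fin n
embed (outside ∷ p) i       = suc (embed p i)
embed (inside  ∷ p) zero    = zero
embed (inside  ∷ p) (suc i) = suc (embed p i)

-- The subgraph induced by the vertex set p, with its vertices renumbered
-- by embed.
_[_] : Graph n → (p : Subset n) → Graph ∣ p ∣
G [ p ] = record
  { Adj    = Adj G on embed p
  ; symm   = symm G
  ; irrefl = λ e → irrefl G (cong (embed p) e)
  ; adj?   = λ u v → adj? G (embed p u) (embed p v)
  }

------------------------------------------------------------------------
-- Colourings and the chromatic number

Proper : {C : Set} → Graph n → (Fin n → C) → Set
Proper G c = ∀ u v → Adj G u v → c u ≢ c v

Colourable : Graph n → ℕ → Set
Colourable {n} G k = ∃[ c ] Proper {C = Fin k} G c

private
  proper? : {C : Set} (_≟ᶜ_ : Decidable {A = C} _≡_) (G : Graph n) → U.Decidable (Proper {C = C} G)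
  proper? _≟ᶜ_ G c = all? (λ u → all? (λ v → adj? G u v →-dec ¬? (c u ≟ᶜ c v)))

  anyFunction? : {P : (Fin m → Fin n) → Set} → (∀ {f g} → f ≗ g → P f → P g) →
                 U.Decidable P → Dec (∃ P)
  anyFunction? resp P? = map′
    (λ { (i , p) → finToFun i , p })
    (λ { (f , p) → funToFin f , resp (λ x → sym (finToFun-funToFin f x)) p })
    (any? (P? ∘ finToFun))

  proper-resp : {C : Set} (G : Graph n) {c d : Fin n → C} → c ≗ d → Proper G c → Proper G d
  proper-resp G c≗d proper u v uv e =
    proper u v uv (trans (c≗d u) (trans e (sym (c≗d v))))

opaque
  χ-exists : (G : Graph n) → ∃ (IsMinimum (Colourable G))
  χ-exists {n} G = minimum
    (λ k → anyFunction? (proper-resp G) (proper? _≟_ G))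
    n (id , λ u v uv u≡v → irrefl G u≡v uv)

χ : Graph n → ℕ
χ G = proj₁ (χ-exists G)

------------------------------------------------------------------------
-- The clique number and perfect graphs

Clique : Graph n → Subset n → Set
Clique G p = ∀ u v → u ∈ p → v ∈ p → u ≢ v → Adj G u v

opaque
  ω-exists : (G : Graph n) → ∃ (IsMaximum (ValueOver (Clique G) ∣_∣))
  ω-exists G = maximumOver
    (λ p → all? (λ u → all? (λ v →
      (u ∈? p) →-dec ((v ∈? p) →-dec (¬? (u ≟ v) →-dec adj? G u v)))))
    (⊥ , λ u v u∈⊥ → contradiction u∈⊥ ∉⊥) ∣_∣

ω : Graph n → ℕ
ω G = proj₁ (ω-exists G)

Perfect : Graph n → Set
Perfect G = ∀ p → Nonempty p → χ (G [ p ]) ≡ ω (G [ p ])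

------------------------------------------------------------------------
-- Connectedness

Connected : Graph n → Set
Connected G = ∀ u v → Star (Adj G) u v

-- Connectedness is decided by Warshall's algorithm: Via ws u v says that
-- v can be reached from u through intermediate vertices taken from ws.
private
  module Warshall (G : Graph n) where

    Via : List (Fin n) → Fin n → Fin n → Set
    Via []       u v = u ≡ v ⊎ Adj G u v
    Via (w ∷ ws) u v = Via ws u v ⊎ (Via ws u w × Via ws w v)

    via? : ∀ ws → Decidable (Via ws)
    via? []       u v = (u ≟ v) ⊎-dec adj? G u v
    via? (w ∷ ws) u v = via? ws u v ⊎-dec (via? ws u w ×-dec via? ws w v)

    lift : ∀ ws {u v} → Via [] u v → Via ws u v
    lift []       x = x
    lift (w ∷ ws) x = inj₁ (lift ws x)

    sound : ∀ ws {u v} → Via ws u v → Star (Adj G) u v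
    sound []       (inj₁ refl)    = ε
    sound []       (inj₂ uv)      = uv ◅ ε
    sound (w ∷ ws) (inj₁ x)       = sound ws x
    sound (w ∷ ws) (inj₂ (x , y)) = sound ws x ◅◅ sound ws y

    join : ∀ ws {u w v} → w ∈ˡ ws → Via ws u w → Via ws w v → Via ws u v
    join (w ∷ ws) (here refl) x y = inj₂ (fst x , snd y)
      where
      fst : ∀ {u} → Via (w ∷ ws) u w → Via ws u w
      fst (inj₁ a)       = a
      fst (inj₂ (a , _)) = a
      snd : ∀ {v} → Via (w ∷ ws) w v → Via ws w v
      snd (inj₁ a)       = a
      snd (inj₂ (_ , a)) = a
    join (w ∷ ws) (there i) (inj₁ a)       (inj₁ b)       = inj₁ (join ws i a b)
    join (w ∷ ws) (there i) (inj₁ a)       (inj₂ (b , d)) = inj₂ (join ws i a b , d)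
    join (w ∷ ws) (there i) (inj₂ (a , b)) (inj₁ d)       = inj₂ (a , join ws i b d)
    join (w ∷ ws) (there i) (inj₂ (a , _)) (inj₂ (_ , d)) = inj₂ (a , d)

    complete : ∀ {u v} → Star (Adj G) u v → Via (allFin n) u v
    complete ε        = lift (allFin n) (inj₁ refl)
    complete (uw ◅ s) = join (allFin n) (∈-allFin _) (lift (allFin n) (inj₂ uw)) (complete s)

connected? : (G : Graph n) → Dec (Connected G)
connected? {n} G = all? λ u → all? λ v →
  map′ (sound (allFin n)) complete (via? (allFin n) u v)
  where open Warshall G

------------------------------------------------------------------------
-- The parameters φ and φ̂

-- c(H), listed without repetition, for the induced subgraph H on p.
usedColours : (Fin n → ℕ) → Subset n → List ℕ
usedColours c p = deduplicate ℕ._≟_ (tabulate (c ∘ embed p))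

-- |c(H)| - χ(H).  For proper c the truncated subtraction is exact, because
-- c restricts to a proper colouring of H with |c(H)| colours.
excess : Graph n → (Fin n → ℕ) → Subset n → ℕ
excess G c p = length (usedColours c p) ∸ χ (G [ p ])

-- An induced subgraph is identified with its (nonempty) vertex set.
ConnectedSet : Graph n → Subset n → Set
ConnectedSet G p = Nonempty p × Connected (G [ p ])

private
  connectedSet? : (G : Graph n) → U.Decidable (ConnectedSet G)
  connectedSet? G p = nonempty? p ×-dec connected? (G [ p ])

  connected-⁅⁆ : (G : Graph n) (x : Fin n) → ConnectedSet G ⁅ x ⁆
  connected-⁅⁆ G x =
    (x , x∈⁅x⁆ x) , λ u v → subst (Star _ u) (unique (∣⁅x⁆∣≡1 x) u v) ε
    where
    unique : ∀ {k} → k ≡ 1 → (u v : Fin k) → u ≡ v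
    unique refl zero zero = refl

  vertex : .{{NonZero n}} → Fin n
  vertex {n} = fromℕ< (>-nonZero⁻¹ n)

module _ {n : ℕ} .{{_ : NonZero n}} where

  opaque
    φ-of-exists : (G : Graph n) (c : Fin n → ℕ) →
                  ∃ (IsMaximum (ValueOver Nonempty (excess G c)))
    φ-of-exists G c =
      maximumOver nonempty? (⁅ vertex ⁆ , vertex , x∈⁅x⁆ vertex) (excess G c)

    φ̂-of-exists : (G : Graph n) (c : Fin n → ℕ) →
                  ∃ (IsMaximum (ValueOver (ConnectedSet G) (excess G c)))
    φ̂-of-exists G c =
      maximumOver (connectedSet? G) (⁅ vertex ⁆ , connected-⁅⁆ G vertex) (excess G c)

  φ-of φ̂-of : Graph n → (Fin n → ℕ) → ℕ
  φ-of  G c = proj₁ (φ-of-exists  G c)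
  φ̂-of G c = proj₁ (φ̂-of-exists G c)

-- The values of F on the proper colourings of G, the colours being
-- arbitrary natural numbers.
ValueOfProper : (G : Graph n) → ((Fin n → ℕ) → ℕ) → ℕ → Set
ValueOfProper {n} G F m = ∃[ c ] Proper {C = ℕ} G c × F c ≡ m

-- For the minimum over the infinitely many colourings to exist
-- constructively, every colouring is replaced by one with colours below n
-- that has the same colour classes.
private
  _∼_ : (c d : Fin n → ℕ) → Set
  c ∼ d = ∀ u v → c u ≡ c v ⇔ d u ≡ d v

  deduplicate-map : (c : Fin n → ℕ) (xs : List (Fin n)) →
    deduplicate ℕ._≟_ (map c xs) ≡ map c (deduplicate (λ u v → c u ℕ.≟ c v) xs)
  deduplicate-map c []       = refl
  deduplicate-map c (x ∷ xs) = cong (c x ∷_) (trans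
    (cong (filter (¬? ∘ (c x ℕ.≟_))) (deduplicate-map c xs))
    (filter-map′ (deduplicate (λ u v → c u ℕ.≟ c v) xs)))
    where
    filter-map′ : ∀ ys → filter (¬? ∘ (c x ℕ.≟_)) (map c ys)
                       ≡ map c (filter (λ v → ¬? (c x ℕ.≟ c v)) ys)
    filter-map′ []       = refl
    filter-map′ (y ∷ ys) with does (c x ℕ.≟ c y)
    ... | false = cong (c y ∷_) (filter-map′ ys)
    ... | true  = filter-map′ ys

  deduplicate-∼ : {c d : Fin n → ℕ} → c ∼ d → ∀ xs →
    deduplicate (λ u v → c u ℕ.≟ c v) xs ≡ deduplicate (λ u v → d u ℕ.≟ d v) xs
  deduplicate-∼ c∼d []       = refl
  deduplicate-∼ {c = c} {d} c∼d (x ∷ xs) = cong (x ∷_) (trans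
    (cong (filter (λ v → ¬? (c x ℕ.≟ c v))) (deduplicate-∼ c∼d xs))
    (filter-≐ _ _
      ( (λ ne e → ne (Equivalence.from (c∼d x _) e))
      , (λ ne e → ne (Equivalence.to   (c∼d x _) e)))
      (deduplicate (λ u v → d u ℕ.≟ d v) xs)))

  length-usedColours : (c : Fin n → ℕ) (p : Subset n) → length (usedColours c p)
    ≡ length (deduplicate (λ u v → c u ℕ.≟ c v) (tabulate (embed p)))
  length-usedColours c p = begin
    length (deduplicate ℕ._≟_ (tabulate (c ∘ embed p)))
      ≡⟨ cong (length ∘ deduplicate ℕ._≟_) (map-tabulate (embed p) c) ⟨
    length (deduplicate ℕ._≟_ (map c (tabulate (embed p))))
      ≡⟨ cong length (deduplicate-map c (tabulate (embed p))) ⟩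
    length (map c (deduplicate (λ u v → c u ℕ.≟ c v) (tabulate (embed p))))
      ≡⟨ length-map c (deduplicate (λ u v → c u ℕ.≟ c v) (tabulate (embed p))) ⟩
    length (deduplicate (λ u v → c u ℕ.≟ c v) (tabulate (embed p))) ∎
    where open ≡-Reasoning

  excess-∼ : (G : Graph n) {c d : Fin n → ℕ} → c ∼ d → excess G c ≗ excess G d
  excess-∼ G {c} {d} c∼d p = cong (_∸ χ (G [ p ])) (trans (length-usedColours c p) (trans
    (cong length (deduplicate-∼ c∼d (tabulate (embed p))))
    (sym (length-usedColours d p))))

  module Representative (c : Fin n → ℕ) where

    Position : ℕ → ℕ → Set
    Position a k = ∃[ y ] toℕ {n} y ≡ k × c y ≡ a

    first : ∀ x → ∃ (IsMinimum (Position (c x)))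
    first x = minimum
      (λ k → any? (λ y → (toℕ y ℕ.≟ k) ×-dec (c y ℕ.≟ c x)))
      (toℕ x) (x , refl , refl)

    rep : Fin n → Fin n
    rep x = proj₁ (proj₁ (proj₂ (first x)))

    c-rep : ∀ x → c (rep x) ≡ c x
    c-rep x = proj₂ (proj₂ (proj₁ (proj₂ (first x))))

    rep-≤ : ∀ x y → c x ≡ c y → toℕ (rep x) ≤ toℕ (rep y)
    rep-≤ x y e with first x
    ... | _ , (_ , refl , _) , least =
      least (toℕ (rep y)) (rep y , refl , trans (c-rep y) (sym e))

    ∼-rep : c ∼ (toℕ ∘ rep)
    ∼-rep x y = mk⇔
      (λ e → ≤-antisym (rep-≤ x y e) (rep-≤ y x (sym e)))
      (λ e → trans (sym (c-rep x)) (trans (cong c (toℕ-injective e)) (c-rep y)))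

  minimumProper : (G : Graph n) (F : (Fin n → ℕ) → ℕ) → (∀ {c d} → c ∼ d → F c ≡ F d) →
                  ∃ (IsMinimum (ValueOfProper G F))
  minimumProper {n} G F F-∼ = minimum
    (λ m → map′ (to m) (from m) (anyFunction? (resp m)
      (λ c → proper? ℕ._≟_ G (toℕ ∘ c) ×-dec (F (toℕ ∘ c) ℕ.≟ m))))
    (F toℕ) (toℕ , (λ u v uv e → irrefl G (toℕ-injective e) uv) , refl)
    where
    Q : ℕ → (Fin n → Fin n) → Set
    Q m c = Proper G (toℕ ∘ c) × F (toℕ ∘ c) ≡ m

    ≗⇒∼ : {c d : Fin n → ℕ} → c ≗ d → c ∼ d
    ≗⇒∼ c≗d u v = mk⇔
      (λ e → trans (sym (c≗d u)) (trans e (c≗d v)))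
      (λ e → trans (c≗d u) (trans e (sym (c≗d v))))

    resp : ∀ m {c d} → c ≗ d → Q m c → Q m d
    resp m c≗d (p , e) =
      proper-resp G (λ x → cong toℕ (c≗d x)) p ,
      trans (sym (F-∼ (≗⇒∼ (λ x → cong toℕ (c≗d x))))) e

    to : ∀ m → ∃ (Q m) → ValueOfProper G F m
    to m (c , q) = toℕ ∘ c , q

    from : ∀ m → ValueOfProper G F m → ∃ (Q m)
    from m (c , p , e) = rep ,
      (λ u v uv eq → p u v uv (Equivalence.from (∼-rep u v) eq)) ,
      trans (sym (F-∼ ∼-rep)) e
      where open Representative c

  maximum-cong : {Q : Subset n → Set} {f g : Subset n → ℕ} → f ≗ g → ∀ {a b} →
                 IsMaximum (ValueOver Q f) a → IsMaximum (ValueOver Q g) b → a ≡ b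
  maximum-cong f≗g ((p , qp , refl) , f≤) ((r , qr , refl) , g≤) = ≤-antisym
    (g≤ _ (p , qp , sym (f≗g p)))
    (f≤ _ (r , qr , f≗g r))

module _ {n : ℕ} .{{_ : NonZero n}} where

  opaque
    φ-exists : (G : Graph n) → ∃ (IsMinimum (ValueOfProper G (φ-of G)))
    φ-exists G = minimumProper G (φ-of G) (λ {c} {d} c∼d →
      maximum-cong (excess-∼ G c∼d) (proj₂ (φ-of-exists G c)) (proj₂ (φ-of-exists G d)))

    φ̂-exists : (G : Graph n) → ∃ (IsMinimum (ValueOfProper G (φ̂-of G)))
    φ̂-exists G = minimumProper G (φ̂-of G) (λ {c} {d} c∼d →
      maximum-cong (excess-∼ G c∼d) (proj₂ (φ̂-of-exists G c)) (proj₂ (φ̂-of-exists G d)))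

  φ φ̂ : Graph n → ℕ
  φ  G = proj₁ (φ-exists  G)
  φ̂ G = proj₁ (φ̂-exists G)

------------------------------------------------------------------------
-- Paw-free and complete multipartite graphs

-- The triangle 0, 1, 2 with the vertex 3 attached to 0.
pawAdj : Fin 4 → Fin 4 → Bool
pawAdj 0F 1F = true
pawAdj 0F 2F = true
pawAdj 0F 3F = true
pawAdj 1F 0F = true
pawAdj 1F 2F = true
pawAdj 2F 0F = true
pawAdj 2F 1F = true
pawAdj 3F 0F = true
pawAdj _  _  = false

paw : Graph 4
paw = record
  { Adj    = λ u v → T (pawAdj u v)
  ; symm   = λ {u} {v} → from-yes (all? λ u → all? λ v →
               T? (pawAdj u v) →-dec T? (pawAdj v u)) u v
  ; irrefl = λ { {u} refl → from-yes (all? λ u → ¬? (T? (pawAdj u u))) u }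
  ; adj?   = λ u v → T? (pawAdj u v)
  }

PawFree : Graph n → Set
PawFree G = ∀ p → ¬ (G [ p ] ≅ paw)

-- The parts are the nonempty fibres of part.
CompleteMultipartite : Graph n → Set
CompleteMultipartite {n} G = ∃[ k ] ∃ λ (part : Fin n → Fin k) →
  (∀ u v → part u ≡ part v → ¬ Adj G u v) ×
  (∀ u v → part u ≢ part v → Adj G u v)

{-# OPTIONS --safe #-}

-- Both parameters are governed by the proper colourings in which the ends of
-- every induced path on three vertices share a colour ("P₃-monochromatic").
--
-- For such a colouring, adjacent vertices v, w see the same colours in N[v] and
-- N[w], and representatives of the colours in N[v] form a clique.  Hence a
-- connected induced subgraph H carries a clique with |c(H)| vertices, so
-- |c(H)| ≤ χ(H), and ranking c(v) among the colours of N[v] colours any H with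
-- ω(H) colours.  Conversely |c(H)| ≤ χ(H) on paths with three vertices forces c to
-- be P₃-monochromatic.  So φ̂(G) = 0 iff such a colouring exists, and then G is
-- perfect and, by inspection, paw-free.
--
-- In a paw-free graph the ends of an induced path on three vertices have the same
-- neighbourhood as soon as one of them lies in a triangle; colouring the vertices
-- in triangles by their neighbourhoods and the others, which induce a bipartite
-- graph by perfection, with two colours gives a P₃-monochromatic colouring.
--
-- For φ, the two-vertex subgraphs force nonadjacent vertices to share a colour.
module Submission where

open import Defs
open import Data.Bool.Base using (true; false; T; if_then_else_)
open import Data.Bool.Properties using (T?)
open import Data.Fin.Base using (Fin; zero; suc; toℕ; fromℕ<; inject≤; combine; finToFun; funToFin)
open import Data.Fin.Patterns using (0F; 1F; 2F; 3F)
open import Data.Fin.Properties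
  using (_≟_; any?; all?; toℕ-injective; suc-injective; injective⇒≤; inject≤-injective;
         fromℕ<-injective; finToFun-funToFin)
open import Data.Fin.Subset using (Subset; inside; outside; _∈_; ∣_∣; Nonempty)
open import Data.Fin.Subset.Properties using (_∈?_; nonempty?)
open import Data.List.Base using (List; []; _∷_; length; lookup; filter; downFrom; tabulate)
open import Data.List.Membership.Propositional using () renaming (_∈_ to _∈ˡ_)
open import Data.List.Membership.Propositional.Properties
  using (∈-lookup; ∈-deduplicate⁺; ∈-deduplicate⁻; ∈-tabulate⁺; ∈-tabulate⁻)
open import Data.List.Properties using (filter-accept; filter-≐)
open import Data.List.Relation.Unary.All as All using (All; []; _∷_)
open import Data.List.Relation.Unary.All.Properties using (all-filter)
open import Data.List.Relation.Unary.AllPairs using ([]; _∷_)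
open import Data.List.Relation.Unary.Any using (index)
open import Data.List.Relation.Unary.Any.Properties using (lookup-index)
open import Data.List.Relation.Unary.Unique.DecPropositional.Properties using (deduplicate-!)
open import Data.List.Relation.Unary.Unique.Propositional using (Unique)
open import Data.List.Relation.Unary.Unique.Propositional.Properties using (filter⁺; downFrom⁺)
open import Data.Nat.Base using (ℕ; zero; suc; _^_; _≤_; _<_; _≤′_; ≤′-refl; ≤′-step; NonZero)
open import Data.Nat.Properties as ℕ using (≤-refl; ≤-reflexive; ≤-trans; n≤1+n)
open import Data.Product using (∃; ∃-syntax; _×_; _,_; proj₁; proj₂)
open import Data.Sum using (_⊎_; inj₁; inj₂)
open import Data.Unit.Base using (⊤)
open import Data.Vec.Base as Vec using ([]; _∷_; here; there)
open import Data.Vec.Properties using (lookup∘tabulate; lookup⇒[]=; []=⇒lookup)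
open import Function.Base using (_∘_; const)
open import Function.Bundles using (_⇔_; mk⇔; mk↔ₛ′; Equivalence; Inverse)
open import Function.Definitions using (Injective)
open import Relation.Binary.Construct.Closure.ReflexiveTransitive using (Star; ε; _◅_; _◅◅_)
open import Relation.Binary.Definitions using (tri<; tri≈; tri>)
open import Relation.Binary.PropositionalEquality
  using (_≡_; _≢_; refl; sym; trans; cong; cong₂; subst; subst₂)
open import Relation.Nullary using (¬_; yes; no; contradiction; ¬?)
open import Relation.Nullary.Decidable
  using (_×-dec_; _⊎-dec_; does; dec-true; decidable-stable; from-yes)
import Relation.Unary as U

private
  variable
    k m n : ℕ
    A : Set
    xs ys : List A

-- Lists without repetition.

lookup-injective : Unique xs → ∀ i j → lookup xs i ≡ lookup xs j → i ≡ j
lookup-injective (_  ∷ _)  zero    zero    _ = refl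
lookup-injective (x∉ ∷ _)  zero    (suc j) e = contradiction e (All.lookup x∉ (∈-lookup j))
lookup-injective (x∉ ∷ _)  (suc i) zero    e = contradiction (sym e) (All.lookup x∉ (∈-lookup i))
lookup-injective (_  ∷ xs) (suc i) (suc j) e = cong suc (lookup-injective xs i j e)

-- Pigeonhole: sending each position of `xs` to a position of the same entry in `ys` is injective.
unique⇒length-≤ : Unique xs → All (_∈ˡ ys) xs → length xs ≤ length ys
unique⇒length-≤ {xs = xs} {ys = ys} unique xs⊆ys = injective⇒≤ {f = position} position-injective
  where
  member : ∀ i → lookup xs i ∈ˡ ys
  member i = All.lookup xs⊆ys (∈-lookup i)

  position : Fin (length xs) → Fin (length ys)
  position i = index (member i)

  position-injective : Injective _≡_ _≡_ position
  position-injective {i} {j} e = lookup-injective unique i j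
    (trans (lookup-index (member i)) (trans (cong (lookup ys) e) (sym (lookup-index (member j)))))

-- Counting below a bound

module _ {P : ℕ → Set} (P? : U.Decidable P) where

  countBelow : ℕ → ℕ
  countBelow b = length (filter P? (downFrom b))

  countBelow-suc : ∀ {a} → P a → countBelow (suc a) ≡ suc (countBelow a)
  countBelow-suc pa = cong length (filter-accept P? pa)

  countBelow-mono : ∀ {a b} → a ≤′ b → countBelow a ≤ countBelow b
  countBelow-mono ≤′-refl = ≤-refl
  countBelow-mono {b = suc b} (≤′-step a≤b) = ≤-trans (countBelow-mono a≤b) step
    where
    step : countBelow b ≤ countBelow (suc b)
    step with does (P? b)
    ... | true  = n≤1+n _
    ... | false = ≤-refl

  -- The number `a` itself is counted below `b` but not below `a`.
  countBelow-< : ∀ {a b} → P a → a < b → countBelow a < countBelow b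
  countBelow-< pa a<b =
    ≤-trans (≤-reflexive (sym (countBelow-suc pa))) (countBelow-mono (ℕ.≤⇒≤′ a<b))

-- Subsets and induced subgraphs

embed-∈ : (p : Subset n) (i : Fin ∣ p ∣) → embed p i ∈ p
embed-∈ (outside ∷ p) i       = there (embed-∈ p i)
embed-∈ (inside  ∷ p) zero    = here
embed-∈ (inside  ∷ p) (suc i) = there (embed-∈ p i)

embed-injective : (p : Subset n) → Injective _≡_ _≡_ (embed p)
embed-injective (outside ∷ p) e = embed-injective p (suc-injective e)
embed-injective (inside  ∷ p) {zero}  {zero}  _ = refl
embed-injective (inside  ∷ p) {suc i} {suc j} e = cong suc (embed-injective p (suc-injective e))

embed⁻¹ : {p : Subset n} {x : Fin n} → x ∈ p → ∃[ i ] embed p i ≡ x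
embed⁻¹ {p = inside ∷ p} here = zero , refl
embed⁻¹ {p = inside ∷ p} (there x∈p) with embed⁻¹ x∈p
... | i , refl = suc i , refl
embed⁻¹ {p = outside ∷ p} (there x∈p) with embed⁻¹ x∈p
... | i , refl = i , refl

module _ {P : Fin n → Set} (P? : U.Decidable P) where

  comprehension : Subset n
  comprehension = Vec.tabulate (does ∘ P?)

  ∈-comprehension⁺ : ∀ {x} → P x → x ∈ comprehension
  ∈-comprehension⁺ {x} px =
    lookup⇒[]= x _ (trans (lookup∘tabulate (does ∘ P?) x) (dec-true (P? x) px))

  ∈-comprehension⁻ : ∀ {x} → x ∈ comprehension → P x
  ∈-comprehension⁻ {x} x∈
    with P? x | trans (sym (lookup∘tabulate (does ∘ P?) x)) ([]=⇒lookup x∈)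
  ... | yes px | _ = px

module _ (f : Fin k → Fin n) where

  image : Subset n
  image = comprehension (λ x → any? (λ i → f i ≟ x))

  ∈-image : ∀ i → f i ∈ image
  ∈-image i = ∈-comprehension⁺ (λ x → any? (λ i → f i ≟ x)) (i , refl)

  preimage : ∀ (x : Fin ∣ image ∣) → ∃[ i ] f i ≡ embed image x
  preimage x = ∈-comprehension⁻ (λ x → any? (λ i → f i ≟ x)) (embed-∈ image x)

induced-image-≅ : (G : Graph n) (H : Graph k) (f : Fin k → Fin n) → Injective _≡_ _≡_ f →
                  (∀ i j → Adj H i j ⇔ Adj G (f i) (f j)) → G [ image f ] ≅ H
induced-image-≅ G H f f-inj adj =
  mk↔ₛ′ to from
    (λ i → f-inj (trans (f-to (from i)) (proj₂ (embed⁻¹ (∈-image f i)))))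
    (λ x → embed-injective (image f) (trans (proj₂ (embed⁻¹ (∈-image f (to x)))) (f-to x))) ,
  λ x y → mk⇔
    (λ a → Equivalence.from (adj _ _) (subst₂ (Adj G) (sym (f-to x)) (sym (f-to y)) a))
    (λ a → subst₂ (Adj G) (f-to x) (f-to y) (Equivalence.to (adj _ _) a))
  where
  to = λ x → proj₁ (preimage f x)
  f-to = λ x → proj₂ (preimage f x)
  from = λ i → proj₁ (embed⁻¹ (∈-image f i))

hub⇒connected : (G : Graph n) (h : Fin n) → (∀ x → x ≡ h ⊎ Adj G x h) → Connected G
hub⇒connected G h near x y = toHub (near x) ◅◅ fromHub (near y)
  where
  toHub : ∀ {x} → x ≡ h ⊎ Adj G x h → Star (Adj G) x h
  toHub (inj₁ refl) = ε
  toHub (inj₂ xh)   = xh ◅ ε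

  fromHub : ∀ {y} → y ≡ h ⊎ Adj G y h → Star (Adj G) h y
  fromHub (inj₁ refl) = ε
  fromHub (inj₂ yh)   = symm G yh ◅ ε

-- Colourings and cliques

χ-colourable : (G : Graph n) → Colourable G (χ G)
χ-colourable G = proj₁ (proj₂ (χ-exists G))

χ-≤ : (G : Graph n) → Colourable G k → χ G ≤ k
χ-≤ G = proj₂ (proj₂ (χ-exists G)) _

colourable-induced⇒ : (G : Graph n) (p : Subset n) → Colourable (G [ p ]) (suc k) →
  ∃ λ (d : Fin n → Fin (suc k)) → ∀ {x y} → x ∈ p → y ∈ p → Adj G x y → d x ≢ d y
colourable-induced⇒ {n} {k} G p (c , proper) = d , d-proper
  where
  d : Fin n → Fin (suc k)
  d x with x ∈? p
  ... | yes x∈p = c (proj₁ (embed⁻¹ x∈p))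
  -- A dummy colour outside `p`; asking for `suc k` colours guarantees that one exists.
  ... | no  _   = zero

  d-proper : ∀ {x y} → x ∈ p → y ∈ p → Adj G x y → d x ≢ d y
  d-proper {x} {y} x∈p y∈p xy with x ∈? p | y ∈? p
  ... | no x∉p | _      = contradiction x∈p x∉p
  ... | _      | no y∉p = contradiction y∈p y∉p
  ... | yes a  | yes b  = proper _ _
    (subst₂ (Adj G) (sym (proj₂ (embed⁻¹ a))) (sym (proj₂ (embed⁻¹ b))) xy)

-- Indexing by `Fin k` avoids cardinalities of subsets; since adjacency is irreflexive, such an `f`
-- is automatically injective.
HasClique : Graph n → ℕ → Set
HasClique {n} G k = ∃ λ (f : Fin k → Fin n) → ∀ {i j} → i ≢ j → Adj G (f i) (f j)

clique-injective : (G : Graph n) (K : HasClique G k) → Injective _≡_ _≡_ (proj₁ K)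
clique-injective G (f , adj) {i} {j} e =
  decidable-stable (i ≟ j) (λ i≢j → irrefl G e (adj i≢j))

clique-≤ω : (G : Graph n) → HasClique G k → k ≤ ω G
clique-≤ω {k = k} G K@(f , adj) = ≤-trans
  (injective⇒≤ {f = λ i → proj₁ (position i)} (λ {i} {j} e → clique-injective G K
    (trans (sym (proj₂ (position i))) (trans (cong (embed (image f)) e) (proj₂ (position j))))))
  (proj₂ (proj₂ (ω-exists G)) _ (image f , image-clique , refl))
  where
  position : ∀ i → ∃[ x ] embed (image f) x ≡ f i
  position i = embed⁻¹ (∈-image f i)

  image-clique : Clique G (image f)
  image-clique u v u∈ v∈ u≢v
    with ∈-comprehension⁻ (λ x → any? (λ i → f i ≟ x)) u∈
       | ∈-comprehension⁻ (λ x → any? (λ i → f i ≟ x)) v∈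
  ... | i , refl | j , refl = adj (λ i≡j → u≢v (cong f i≡j))

ω-clique : (G : Graph n) → HasClique G (ω G)
ω-clique G with proj₁ (proj₂ (ω-exists G))
... | p , clique , e = subst (HasClique G) e
  (embed p , λ i≢j → clique _ _ (embed-∈ p _) (embed-∈ p _) (i≢j ∘ embed-injective p))

clique-shrink : (G : Graph n) → m ≤ k → HasClique G k → HasClique G m
clique-shrink G m≤k (f , adj) =
  f ∘ (λ i → inject≤ i m≤k) , λ i≢j → adj (i≢j ∘ inject≤-injective m≤k m≤k _ _)

clique-≤colours : (G : Graph n) → HasClique G k → Colourable G m → k ≤ m
clique-≤colours G (f , adj) (c , proper) = injective⇒≤ {f = c ∘ f} λ {i} {j} e →
  decidable-stable (i ≟ j) (λ i≢j → proper _ _ (adj i≢j) e)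

clique-≤χ : (G : Graph n) → HasClique G k → k ≤ χ G
clique-≤χ G K = clique-≤colours G K (χ-colourable G)

-- Pick one vertex satisfying `Q` for each colour in `as`. Later `Q` is a closed neighbourhood or
-- holds of all vertices.
rainbow-clique : (G : Graph n) (c : Fin n → ℕ) {Q : Fin n → Set} →
  (∀ {x y} → Q x → Q y → c x ≢ c y → Adj G x y) →
  ∀ {as} → Unique as → All (λ a → ∃[ x ] Q x × c x ≡ a) as → HasClique G (length as)
rainbow-clique G c adj {as} unique seen =
  (λ i → proj₁ (rep i)) , λ {i} {j} i≢j → adj (proj₁ (proj₂ (rep i))) (proj₁ (proj₂ (rep j)))
    λ e → i≢j (lookup-injective unique i j
      (trans (sym (proj₂ (proj₂ (rep i)))) (trans e (proj₂ (proj₂ (rep j))))))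
  where
  rep = λ i → All.lookup seen (∈-lookup i)

∈-usedColours : (c : Fin n → ℕ) {p : Subset n} {x : Fin n} → x ∈ p → c x ∈ˡ usedColours c p
∈-usedColours c x∈p with embed⁻¹ x∈p
... | i , refl = ∈-deduplicate⁺ ℕ._≟_ (∈-tabulate⁺ i)

usedColours-unique : (c : Fin n → ℕ) (p : Subset n) → Unique (usedColours c p)
usedColours-unique c p = deduplicate-! ℕ._≟_ (tabulate (c ∘ embed p))

usedColours-seen : (c : Fin n → ℕ) (p : Subset n) →
                   All (λ a → ∃[ i ] a ≡ c (embed p i)) (usedColours c p)
usedColours-seen c p = All.tabulate λ a∈ → ∈-tabulate⁻ (∈-deduplicate⁻ ℕ._≟_ _ a∈)

-- Truncated subtraction vanishes only if |c(H)| ≤ χ(H), and χ(H) ≤ `k`.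
excess≡0⇒colours-≤ : (G : Graph n) (c : Fin n → ℕ) {p : Subset n} → excess G c p ≡ 0 →
  Colourable (G [ p ]) k → ∀ {as} → Unique as → All (_∈ˡ usedColours c p) as → length as ≤ k
excess≡0⇒colours-≤ G c {p} e colourable unique as⊆ =
  ≤-trans (unique⇒length-≤ unique as⊆)
    (≤-trans (ℕ.m∸n≡0⇒m≤n e) (χ-≤ (G [ p ]) colourable))

-- P₃-monochromatic colourings

P₃Mono : {C : Set} → Graph n → (Fin n → C) → Set
P₃Mono G c = ∀ u w v → Adj G u w → Adj G w v → ¬ Adj G u v → c u ≡ c v

module _ (G : Graph n) (c : Fin n → ℕ) (proper : Proper G c) (mono : P₃Mono G c) where

  ClosedNbhd : Fin n → Fin n → Set
  ClosedNbhd v x = x ≡ v ⊎ Adj G v x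

  Near : Fin n → ℕ → Set
  Near v a = ∃[ x ] ClosedNbhd v x × c x ≡ a

  near? : ∀ v → U.Decidable (Near v)
  near? v a = any? (λ x → ((x ≟ v) ⊎-dec adj? G v x) ×-dec (c x ℕ.≟ a))

  -- A neighbour `x` of `v` is adjacent to `w` or shares the colour of `w`, by the path `x`, `v`,
  -- `w`. The case where `x` is `w` falls under the latter.
  near-step : ∀ {v w a} → Adj G v w → Near v a → Near w a
  near-step {v} vw (_ , inj₁ refl , e) = v , inj₂ (symm G vw) , e
  near-step {v} {w} vw (x , inj₂ vx , e) with adj? G w x
  ... | yes wx = x , inj₂ wx , e
  ... | no ¬wx = w , inj₁ refl , trans (sym (mono x v w (symm G vx) vw (¬wx ∘ symm G))) e

  near-star : ∀ {v w a} → Star (Adj G) v w → Near v a → Near w a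
  near-star ε        near = near
  near-star (vw ◅ s) near = near-star s (near-step vw near)

  -- Two nonadjacent neighbours of `v` are joined by a path through `v`, so `mono` gives them one
  -- colour.
  rainbow-nbhd : ∀ {v x y} → ClosedNbhd v x → ClosedNbhd v y → c x ≢ c y → Adj G x y
  rainbow-nbhd (inj₁ refl) (inj₁ refl) ne = contradiction refl ne
  rainbow-nbhd (inj₁ refl) (inj₂ vy)   ne = vy
  rainbow-nbhd (inj₂ vx)   (inj₁ refl) ne = symm G vx
  rainbow-nbhd {v} {x} {y} (inj₂ vx) (inj₂ vy) ne =
    decidable-stable (adj? G x y) (λ ¬xy → ne (mono x v y (symm G vx) vy ¬xy))

  near-clique : ∀ v {as} → Unique as → All (Near v) as → HasClique G (length as)
  near-clique v = rainbow-clique G c rainbow-nbhd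

  rank : Fin n → ℕ
  rank v = countBelow (near? v) (c v)

  -- The colours in N[v] up to and including `c v` number `suc (rank v)`, and representatives of
  -- them form a clique.
  rank-<ω : ∀ v → rank v < ω G
  rank-<ω v = ≤-trans
    (≤-reflexive (sym (countBelow-suc (near? v) (v , inj₁ refl , refl))))
    (clique-≤ω G (near-clique v
      (filter⁺ (near? v) (downFrom⁺ (suc (c v)))) (all-filter (near? v) (downFrom (suc (c v))))))

  -- By `near-step` both ranks count within one set of colours, and `c v` is counted only for `w`.
  rank-< : ∀ {v w} → Adj G v w → c v < c w → rank v < rank w
  rank-< {v} {w} vw cv<cw = ℕ.<-≤-trans
    (countBelow-< (near? v) (v , inj₁ refl , refl) cv<cw)
    (≤-reflexive (cong length
      (filter-≐ (near? v) (near? w) (near-step vw , near-step (symm G vw)) (downFrom (c w)))))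

  rank-proper : Proper G rank
  rank-proper v w vw e with ℕ.<-cmp (c v) (c w)
  ... | tri< lt _ _ = ℕ.<⇒≢ (rank-< vw lt) e
  ... | tri≈ _ eq _ = proper v w vw eq
  ... | tri> _ _ gt = ℕ.<⇒≢ (rank-< (symm G vw) gt) (sym e)

  P₃Mono⇒χ≤ω : χ G ≤ ω G
  P₃Mono⇒χ≤ω = χ-≤ G
    ( (λ v → fromℕ< (rank-<ω v))
    , λ v w vw e → rank-proper v w vw (fromℕ<-injective _ _ (rank-<ω v) (rank-<ω w) e))

module _ (G : Graph n) (c : Fin n → ℕ) (proper : Proper G c) where

  proper-induced : ∀ p → Proper (G [ p ]) (c ∘ embed p)
  proper-induced p u v = proper (embed p u) (embed p v)

  -- If the ends had different colours, the path would be a connected bipartite subgraph using three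
  -- colours.
  connected-excess⇒P₃Mono : (∀ p → ConnectedSet G p → excess G c p ≡ 0) → P₃Mono G c
  connected-excess⇒P₃Mono excess≡0 u w v uw wv ¬uv = decidable-stable (c u ℕ.≟ c v) λ cu≢cv →
    contradiction
      (excess≡0⇒colours-≤ G c
        (excess≡0 p ((w , ∈-image f 1F) , hub⇒connected (G [ p ]) hub near-hub))
        (colour , colour-proper)
        ((proper u w uw ∷ cu≢cv ∷ []) ∷ (proper w v wv ∷ []) ∷ [] ∷ [])
        (∈-usedColours c (∈-image f 0F) ∷ ∈-usedColours c (∈-image f 1F) ∷
         ∈-usedColours c (∈-image f 2F) ∷ []))
      ℕ.1+n≰n
    where
    f : Fin 3 → Fin n
    f = lookup (u ∷ w ∷ v ∷ [])

    p : Subset n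
    p = image f

    hub : Fin ∣ p ∣
    hub = proj₁ (embed⁻¹ (∈-image f 1F))

    embed-hub : embed p hub ≡ w
    embed-hub = proj₂ (embed⁻¹ (∈-image f 1F))

    near-hub : ∀ x → x ≡ hub ⊎ Adj (G [ p ]) x hub
    near-hub x with preimage f x
    ... | 0F , e = inj₂ (subst₂ (Adj G) e (sym embed-hub) uw)
    ... | 1F , e = inj₁ (embed-injective p (trans (sym e) (sym embed-hub)))
    ... | 2F , e = inj₂ (subst₂ (Adj G) e (sym embed-hub) (symm G wv))

    colourOf : Fin 3 → Fin 2
    colourOf 1F = 1F
    colourOf _  = 0F

    -- `preimage` may choose any index of a vertex; `colourOf-proper` covers every choice.
    colour : Fin ∣ p ∣ → Fin 2
    colour x = colourOf (proj₁ (preimage f x))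

    colourOf-proper : ∀ i j → Adj G (f i) (f j) → colourOf i ≢ colourOf j
    colourOf-proper 0F 0F a _ = irrefl G refl a
    colourOf-proper 0F 2F a _ = ¬uv a
    colourOf-proper 1F 1F a _ = irrefl G refl a
    colourOf-proper 2F 0F a _ = ¬uv (symm G a)
    colourOf-proper 2F 2F a _ = irrefl G refl a

    colour-proper : Proper (G [ p ]) colour
    colour-proper x y xy = colourOf-proper (proj₁ (preimage f x)) (proj₁ (preimage f y))
      (subst₂ (Adj G) (sym (proj₂ (preimage f x))) (sym (proj₂ (preimage f y))) xy)

  -- With different colours, `u` and `v` would form a disconnected set with two colours and
  -- chromatic number 1, which only φ takes into account.
  excess⇒nonadjacent-mono : (∀ p → Nonempty p → excess G c p ≡ 0) →
                            ∀ u v → ¬ Adj G u v → c u ≡ c v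
  excess⇒nonadjacent-mono excess≡0 u v ¬uv = decidable-stable (c u ℕ.≟ c v) λ cu≢cv →
    contradiction
      (excess≡0⇒colours-≤ G c (excess≡0 p (u , ∈-image f 0F)) 1-colourable
        ((cu≢cv ∷ []) ∷ [] ∷ [])
        (∈-usedColours c (∈-image f 0F) ∷ ∈-usedColours c (∈-image f 1F) ∷ []))
      ℕ.1+n≰n
    where
    f : Fin 2 → Fin n
    f = lookup (u ∷ v ∷ [])

    p : Subset n
    p = image f

    independent : ∀ i j → ¬ Adj G (f i) (f j)
    independent 0F 0F a = irrefl G refl a
    independent 0F 1F a = ¬uv a
    independent 1F 0F a = ¬uv (symm G a)
    independent 1F 1F a = irrefl G refl a

    1-colourable : Colourable (G [ p ]) 1
    1-colourable = (λ _ → 0F) , λ x y xy _ → independent (proj₁ (preimage f x)) (proj₁ (preimage f y))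
      (subst₂ (Adj G) (sym (proj₂ (preimage f x))) (sym (proj₂ (preimage f y))) xy)

  module _ (mono : P₃Mono G c) where

    mono-induced : ∀ p → P₃Mono (G [ p ]) (c ∘ embed p)
    mono-induced p u w v = mono (embed p u) (embed p w) (embed p v)

    -- Both hypotheses on `c` pass to induced subgraphs, so the ranking colours each of them
    -- optimally.
    P₃Mono⇒perfect : Perfect G
    P₃Mono⇒perfect p _ = ℕ.≤-antisym
      (P₃Mono⇒χ≤ω (G [ p ]) (c ∘ embed p) (proper-induced p) (mono-induced p))
      (clique-≤χ (G [ p ]) (ω-clique (G [ p ])))

    -- Walks carry every colour used on `p` to the closed neighbourhood of one fixed vertex `v`,
    -- where representatives form a clique.
    P₃Mono⇒connected-excess : ∀ p → ConnectedSet G p → excess G c p ≡ 0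
    P₃Mono⇒connected-excess p ((x , x∈p) , connected) = ℕ.m≤n⇒m∸n≡0 (clique-≤χ (G [ p ])
      (near-clique (G [ p ]) (c ∘ embed p) (proper-induced p) (mono-induced p) v
        (usedColours-unique c p)
        (All.map (λ (i , e) → near-star (G [ p ]) (c ∘ embed p) (proper-induced p) (mono-induced p)
            (connected i v) (i , inj₁ refl , sym e))
          (usedColours-seen c p))))
      where
      v : Fin ∣ p ∣
      v = proj₁ (embed⁻¹ x∈p)

    -- The induced paths 1-0-3 and 2-0-3 of a paw give the adjacent vertices 1 and 2 the colour of
    -- 3.
    P₃Mono⇒pawFree : PawFree G
    P₃Mono⇒pawFree p (f , adj) = proper (v 1F) (v 2F) (edge 1F 2F _)
      (trans (mono _ (v 0F) _ (edge 1F 0F _) (edge 0F 3F _) (nonedge 1F 3F (λ ())))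
        (sym (mono _ (v 0F) _ (edge 2F 0F _) (edge 0F 3F _) (nonedge 2F 3F (λ ())))))
      where
      v : Fin 4 → Fin n
      v i = embed p (Inverse.from f i)

      edge : ∀ i j → T (pawAdj i j) → Adj G (v i) (v j)
      edge i j a = Equivalence.from (adj _ _)
        (subst₂ (Adj paw) (sym (Inverse.strictlyInverseˡ f i)) (sym (Inverse.strictlyInverseˡ f j)) a)

      nonedge : ∀ i j → ¬ T (pawAdj i j) → ¬ Adj G (v i) (v j)
      nonedge i j ¬a a = ¬a
        (subst₂ (Adj paw) (Inverse.strictlyInverseˡ f i) (Inverse.strictlyInverseˡ f j)
          (Equivalence.to (adj _ _) a))

-- Colouring vertices by their neighbourhoods

funToFin-cong : {f g : Fin m → Fin n} → (∀ i → f i ≡ g i) → funToFin f ≡ funToFin g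
funToFin-cong {zero}  f≗g = refl
funToFin-cong {suc m} f≗g = cong₂ combine (f≗g zero) (funToFin-cong (f≗g ∘ suc))

module _ (G : Graph n) where

  adjBit : Fin n → Fin n → Fin 2
  adjBit x v = if does (adj? G x v) then 1F else 0F

  -- The characteristic vector of the open neighbourhood, packed into one number so that it can
  -- serve as a colour and as the label of a part.
  nbhdCode : Fin n → Fin (2 ^ n)
  nbhdCode x = funToFin (adjBit x)

  twins⇒code≡ : ∀ {x y} → (∀ {v} → Adj G x v → Adj G y v) → (∀ {v} → Adj G y v → Adj G x v) →
                nbhdCode x ≡ nbhdCode y
  twins⇒code≡ {x} {y} x⊆y y⊆x = funToFin-cong bits
    where
    bits : ∀ v → adjBit x v ≡ adjBit y v
    bits v with adj? G x v | adj? G y v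
    ... | yes _  | yes _  = refl
    ... | no  _  | no  _  = refl
    ... | yes xv | no ¬yv = contradiction (x⊆y xv) ¬yv
    ... | no ¬xv | yes yv = contradiction (y⊆x yv) ¬xv

  -- Decoding both codes at `v` equates the two bits, which rules out that `x` but not `y` is
  -- adjacent to `v`.
  code≡⇒twins : ∀ {x y v} → nbhdCode x ≡ nbhdCode y → Adj G x v → Adj G y v
  code≡⇒twins {x} {y} {v} e xv
    with adj? G x v | adj? G y v
       | trans (sym (finToFun-funToFin (adjBit x) v))
           (trans (cong (λ i → finToFun i v) e) (finToFun-funToFin (adjBit y) v))
  ... | _      | yes yv | _ = yv
  ... | no ¬xv | no _   | _ = contradiction xv ¬xv

  -- If adjacent `u` and `v` had one neighbourhood, `v` would be its own neighbour.
  nbhdCode-proper : Proper G nbhdCode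
  nbhdCode-proper u v uv e = irrefl G refl (code≡⇒twins e uv)

  -- If `x` were adjacent to `u` and not to `v`, then `u`, `v` and `x` would share a colour; so
  -- nonadjacent vertices are twins. Labels must lie in some `Fin k` while `c` takes arbitrary
  -- values, hence the parts are given by neighbourhoods.
  nonadjacent-mono⇒completeMultipartite : (c : Fin n → ℕ) → Proper G c →
    (∀ u v → ¬ Adj G u v → c u ≡ c v) → CompleteMultipartite G
  nonadjacent-mono⇒completeMultipartite c proper mono =
    2 ^ n , nbhdCode , (λ u v e uv → nbhdCode-proper u v uv e) , λ u v ne →
      decidable-stable (adj? G u v) (λ ¬uv → ne (twins⇒code≡ (transfer ¬uv) (transfer (¬uv ∘ symm G))))
    where
    transfer : ∀ {u v x} → ¬ Adj G u v → Adj G u x → Adj G v x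
    transfer {u} {v} {x} ¬uv ux = decidable-stable (adj? G v x) λ ¬vx →
      proper u x ux (trans (mono u v ¬uv) (mono v x ¬vx))

-- Paw-free graphs

-- This makes every map from the paw that preserves and reflects adjacency injective, so
-- `f-injective` need not compare vertices pair by pair.
paw-rows-distinct : ∀ i j → i ≡ j ⊎ (∃[ k ] T (pawAdj i k) × ¬ T (pawAdj j k))
                                  ⊎ (∃[ k ] T (pawAdj j k) × ¬ T (pawAdj i k))
paw-rows-distinct = from-yes (all? λ i → all? λ j → (i ≟ j)
  ⊎-dec (any? (λ k → T? (pawAdj i k) ×-dec ¬? (T? (pawAdj j k)))
  ⊎-dec any? (λ k → T? (pawAdj j k) ×-dec ¬? (T? (pawAdj i k)))))

module _ (G : Graph n) (pawFree : PawFree G) where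

  -- Otherwise the triangle `x`, `a`, `b` with `y` attached at `x` would be an induced paw.
  triangle-attach : ∀ {x a b y} → Adj G x a → Adj G x b → Adj G a b → Adj G x y →
                    Adj G y a ⊎ Adj G y b
  triangle-attach {x} {a} {b} {y} xa xb ab xy with adj? G y a | adj? G y b
  ... | yes ya | _      = inj₁ ya
  ... | no _   | yes yb = inj₂ yb
  ... | no ¬ya | no ¬yb =
    contradiction (induced-image-≅ G paw f f-injective same) (pawFree (image f))
    where
    f : Fin 4 → Fin n
    f = lookup (x ∷ a ∷ b ∷ y ∷ [])

    holds : {A : Set} → A → T true ⇔ A
    holds a = mk⇔ (λ _ → a) _

    fails : {A : Set} → ¬ A → T false ⇔ A
    fails ¬a = mk⇔ (λ ()) ¬a

    same : ∀ i j → T (pawAdj i j) ⇔ Adj G (f i) (f j)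
    same 0F 0F = fails (irrefl G refl)
    same 0F 1F = holds xa
    same 0F 2F = holds xb
    same 0F 3F = holds xy
    same 1F 0F = holds (symm G xa)
    same 1F 1F = fails (irrefl G refl)
    same 1F 2F = holds ab
    same 1F 3F = fails (¬ya ∘ symm G)
    same 2F 0F = holds (symm G xb)
    same 2F 1F = holds (symm G ab)
    same 2F 2F = fails (irrefl G refl)
    same 2F 3F = fails (¬yb ∘ symm G)
    same 3F 0F = holds (symm G xy)
    same 3F 1F = fails ¬ya
    same 3F 2F = fails ¬yb
    same 3F 3F = fails (irrefl G refl)

    rows : ∀ {i j} k → f i ≡ f j → T (pawAdj i k) → T (pawAdj j k)
    rows k e a = Equivalence.from (same _ k)
      (subst (λ z → Adj G z (f k)) e (Equivalence.to (same _ k) a))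

    f-injective : Injective _≡_ _≡_ f
    f-injective {i} {j} e with paw-rows-distinct i j
    ... | inj₁ i≡j                  = i≡j
    ... | inj₂ (inj₁ (k , ik , ¬jk)) = contradiction (rows k e ik) ¬jk
    ... | inj₂ (inj₂ (k , jk , ¬ik)) = contradiction (rows k (sym e) jk) ¬ik

  triangle-attach′ : ∀ {x a b y} → Adj G x a → Adj G x b → Adj G a b → Adj G x y →
                     ¬ Adj G y a → Adj G y b
  triangle-attach′ xa xb ab xy ¬ya with triangle-attach xa xb ab xy
  ... | inj₁ ya = contradiction ya ¬ya
  ... | inj₂ yb = yb

  InTriangle : Fin n → Set
  InTriangle x = ∃[ a ] ∃[ b ] Adj G x a × Adj G x b × Adj G a b

  inTriangle? : U.Decidable InTriangle
  inTriangle? x = any? λ a → any? λ b → adj? G x a ×-dec adj? G x b ×-dec adj? G a b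

  -- By `triangle-attach`, `a` or `b` completes a triangle on the edge from `x` to `y`.
  edge-inTriangle : ∀ {x y} → InTriangle x → Adj G x y → ∃[ t ] Adj G x t × Adj G y t
  edge-inTriangle (a , b , xa , xb , ab) xy with triangle-attach xa xb ab xy
  ... | inj₁ ya = a , xa , ya
  ... | inj₂ yb = b , xb , yb

  inTriangle-step : ∀ {x y} → Adj G x y → InTriangle x → InTriangle y
  inTriangle-step xy tri with edge-inTriangle tri xy
  ... | t , xt , yt = _ , t , symm G xy , yt , xt

  -- Let `t` complete a triangle on `x` and `w`. Then `y` is adjacent to both `w` and `t`, and `v`
  -- to at least one of them, say s. As `y` is attached at s to the triangle `x`, `v`, s and is not
  -- adjacent to `x`, it is adjacent to `v`.
  P₃-nbhd-⊆ : ∀ {x w y v} → InTriangle x → Adj G x w → Adj G w y → ¬ Adj G x y →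
              Adj G x v → Adj G y v
  P₃-nbhd-⊆ tri xw wy ¬xy xv with edge-inTriangle tri xw
  ... | t , xt , wt
    with triangle-attach xw xt wt xv
       | triangle-attach′ (symm G xw) wt xt wy (¬xy ∘ symm G)
  ... | inj₁ vw | yt = triangle-attach′ (symm G xw) (symm G vw) xv wy (¬xy ∘ symm G)
  ... | inj₂ vt | yt = triangle-attach′ (symm G xt) (symm G vt) xv (symm G yt) (¬xy ∘ symm G)

  P₃-twins : ∀ {x w y} → InTriangle x → Adj G x w → Adj G w y → ¬ Adj G x y →
             nbhdCode G x ≡ nbhdCode G y
  P₃-twins tri xw wy ¬xy = twins⇒code≡ G
    (P₃-nbhd-⊆ tri xw wy ¬xy)
    (P₃-nbhd-⊆ (inTriangle-step wy (inTriangle-step xw tri)) (symm G wy) (symm G xw) (¬xy ∘ symm G))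

  triangleFreePart : Subset n
  triangleFreePart = comprehension (¬? ∘ inTriangle?)

  -- A clique of three vertices here would put its first vertex in a triangle.
  triangleFreePart-ω≤2 : ω (G [ triangleFreePart ]) ≤ 2
  triangleFreePart-ω≤2 = ℕ.≮⇒≥ λ 3≤ω →
    let f , adj = clique-shrink (G [ triangleFreePart ]) 3≤ω (ω-clique (G [ triangleFreePart ]))
    in ∈-comprehension⁻ (¬? ∘ inTriangle?) (embed-∈ triangleFreePart (f 0F))
         (_ , _ , adj {0F} {1F} (λ ()) , adj {0F} {2F} (λ ()) , adj {1F} {2F} (λ ()))

  TwoColouring : (Fin n → Fin 2) → Set
  TwoColouring d = ∀ {x y} → ¬ InTriangle x → ¬ InTriangle y → Adj G x y → d x ≢ d y

  triangleFreePart-2-colourable : Perfect G → ∃ TwoColouring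
  triangleFreePart-2-colourable perfect with nonempty? triangleFreePart
  -- `Perfect` speaks of nonempty sets only; with every vertex in a triangle, any colouring will do.
  ... | no empty = const 0F , λ ¬tri _ _ _ → empty (_ , ∈-comprehension⁺ (¬? ∘ inTriangle?) ¬tri)
  ... | yes nonempty =
    let c , proper = χ-colourable (G [ triangleFreePart ])
        χ≤2 = ≤-trans (≤-reflexive (perfect _ nonempty)) triangleFreePart-ω≤2
        d , d-proper = colourable-induced⇒ G triangleFreePart
          ( (λ i → inject≤ (c i) χ≤2)
          , λ u v uv e → proper u v uv (inject≤-injective χ≤2 χ≤2 _ _ e))
    in d , λ ¬tx ¬ty → d-proper (∈-comprehension⁺ (¬? ∘ inTriangle?) ¬tx) (∈-comprehension⁺ (¬? ∘ inTriangle?) ¬ty)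

  module _ (d : Fin n → Fin 2) (d-proper : TwoColouring d) where

    -- The two ranges of colours may overlap: by `inTriangle-step`, no edge joins a vertex in a
    -- triangle to one outside all triangles.
    pawFreeColour : Fin n → ℕ
    pawFreeColour x with inTriangle? x
    ... | yes _ = toℕ (nbhdCode G x)
    ... | no  _ = toℕ (d x)

    pawFreeColour-proper : Proper G pawFreeColour
    pawFreeColour-proper u v uv e with inTriangle? u | inTriangle? v
    ... | yes _  | yes _  = nbhdCode-proper G u v uv (toℕ-injective e)
    ... | no ¬tu | no ¬tv = d-proper ¬tu ¬tv uv (toℕ-injective e)
    ... | yes tu | no ¬tv = ¬tv (inTriangle-step uv tu)
    ... | no ¬tu | yes tv = ¬tu (inTriangle-step (symm G uv) tv)

    pawFreeColour-mono : P₃Mono G pawFreeColour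
    pawFreeColour-mono u w v uw wv ¬uv with inTriangle? u | inTriangle? v
    ... | yes tu | yes _  = cong toℕ (P₃-twins tu uw wv ¬uv)
    ... | yes tu | no ¬tv = contradiction (inTriangle-step wv (inTriangle-step uw tu)) ¬tv
    ... | no ¬tu | yes tv =
      contradiction (inTriangle-step (symm G uw) (inTriangle-step (symm G wv) tv)) ¬tu
    ... | no ¬tu | no ¬tv =
      -- Both ends avoid the colour of `w`, which leaves only one of the two colours.
      cong toℕ (third-is-unique (d-proper ¬tu ¬tw uw) (d-proper ¬tv ¬tw (symm G wv)))
      where
      ¬tw : ¬ InTriangle w
      ¬tw tw = ¬tv (inTriangle-step wv tw)

      third-is-unique : ∀ {a b z : Fin 2} → a ≢ z → b ≢ z → a ≡ b
      third-is-unique {0F} {0F} _ _ = refl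
      third-is-unique {1F} {1F} _ _ = refl
      third-is-unique {0F} {1F} {0F} a≢z _ = contradiction refl a≢z
      third-is-unique {0F} {1F} {1F} _ b≢z = contradiction refl b≢z
      third-is-unique {1F} {0F} {0F} _ b≢z = contradiction refl b≢z
      third-is-unique {1F} {0F} {1F} a≢z _ = contradiction refl a≢z

-- Vanishing of the two parameters.

module _ {n : ℕ} .{{_ : NonZero n}} (G : Graph n) where

  -- The minimum is attained at some `c`, whose maximum 0 bounds every excess. Conversely a maximum
  -- is attained, so it is 0 once every excess is.
  φ̂≡0⇔ : φ̂ G ≡ 0 ⇔ (∃[ c ] Proper G c × (∀ p → ConnectedSet G p → excess G c p ≡ 0))
  φ̂≡0⇔ = mk⇔ to λ (c , proper , excess≡0) → ℕ.n≤0⇒n≡0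
    (proj₂ (proj₂ (φ̂-exists G)) 0 (c , proper , value c (excess≡0 _)))
    where
    to : φ̂ G ≡ 0 → _
    to φ̂≡0 with proj₁ (proj₂ (φ̂-exists G))
    ... | c , proper , e = c , proper , λ p connected → ℕ.n≤0⇒n≡0
      (subst (excess G c p ≤_) (trans e φ̂≡0)
        (proj₂ (proj₂ (φ̂-of-exists G c)) _ (p , connected , refl)))

    value : ∀ c → (∀ {p} → ConnectedSet G p → excess G c p ≡ 0) → φ̂-of G c ≡ 0
    value c excess≡0 with proj₁ (proj₂ (φ̂-of-exists G c))
    ... | p , connected , e = trans (sym e) (excess≡0 connected)

  φ≡0⇔ : φ G ≡ 0 ⇔ (∃[ c ] Proper G c × (∀ p → Nonempty p → excess G c p ≡ 0))
  φ≡0⇔ = mk⇔ to λ (c , proper , excess≡0) → ℕ.n≤0⇒n≡0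
    (proj₂ (proj₂ (φ-exists G)) 0 (c , proper , value c (excess≡0 _)))
    where
    to : φ G ≡ 0 → _
    to φ≡0 with proj₁ (proj₂ (φ-exists G))
    ... | c , proper , e = c , proper , λ p nonempty → ℕ.n≤0⇒n≡0
      (subst (excess G c p ≤_) (trans e φ≡0)
        (proj₂ (proj₂ (φ-of-exists G c)) _ (p , nonempty , refl)))

    value : ∀ c → (∀ {p} → Nonempty p → excess G c p ≡ 0) → φ-of G c ≡ 0
    value c excess≡0 with proj₁ (proj₂ (φ-of-exists G c))
    ... | p , nonempty , e = trans (sym e) (excess≡0 nonempty)

-- With the parts as colour classes, one vertex from each part meeting `p` gives a clique with as
-- many vertices as colours used.
completeMultipartite⇒excess : (G : Graph n) → CompleteMultipartite G →
  ∃[ c ] Proper G c × (∀ p → Nonempty p → excess G c p ≡ 0)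
completeMultipartite⇒excess G (k , part , independent , complete) =
  toℕ ∘ part , (λ u v uv e → independent u v (toℕ-injective e) uv) , λ p _ →
    ℕ.m≤n⇒m∸n≡0 (clique-≤χ (G [ p ])
      (rainbow-clique (G [ p ]) (toℕ ∘ part ∘ embed p) {Q = λ _ → ⊤}
        (λ _ _ ne → complete _ _ (ne ∘ cong toℕ))
        (usedColours-unique (toℕ ∘ part) p)
        (All.map (λ (i , e) → i , _ , sym e) (usedColours-seen (toℕ ∘ part) p))))

theorem5p2 : (n : ℕ) .{{_ : NonZero n}} (G : Graph n) →
    (φ̂ G ≡ 0 ⇔ (PawFree G × Perfect G)) ×
    (φ G ≡ 0 ⇔ CompleteMultipartite G)
theorem5p2 n G =
  mk⇔
    (λ φ̂≡0 →
      let c , proper , excess≡0 = Equivalence.to (φ̂≡0⇔ G) φ̂≡0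
          mono = connected-excess⇒P₃Mono G c proper excess≡0
      in P₃Mono⇒pawFree G c proper mono , P₃Mono⇒perfect G c proper mono)
    (λ (pawFree , perfect) →
      let d , d-proper = triangleFreePart-2-colourable G pawFree perfect
          c = pawFreeColour G pawFree d d-proper
          proper = pawFreeColour-proper G pawFree d d-proper
      in Equivalence.from (φ̂≡0⇔ G) (c , proper ,
           P₃Mono⇒connected-excess G c proper (pawFreeColour-mono G pawFree d d-proper))) ,
  mk⇔
    (λ φ≡0 →
      let c , proper , excess≡0 = Equivalence.to (φ≡0⇔ G) φ≡0
      in nonadjacent-mono⇒completeMultipartite G c proper
           (excess⇒nonadjacent-mono G c proper excess≡0))
    (λ multipartite → Equivalence.from (φ≡0⇔ G) (completeMultipartite⇒excess G multipartite))
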